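{- Let $\alpha \leq \kappa(\mathfrak{Small})$ be a regular cardinal that is also a strong limit cardinal, let $\mathfrak{J}_\alpha$ be a set of $\alpha$-small sets containing all $\alpha$-small cardinals, and let $G$ be a $\mathfrak{J}_\alpha$-ary clone on an $\alpha$-small set $A$. Then the $\mathfrak{J}_\alpha$-ary centralizer $G^\perp$ is the set of all $\mathfrak{J}_\alpha$-ary operations $f:A^J \rightarrow A$ such that $h(f) = f(h \circ u_J)$ for every operation $h:A^{(A^J)} \rightarrow A$ of arity $A^J$ in $G$, where $u_J:J \to A^{(A^J)}$ is the map that sends each $j \in J$ to the projection $\pi_j:A^J\to A$.
   Context: Fix a Grothendieck universe $\mathfrak{Small}$, i.e. the set of all sets of rank less than a fixed inaccessible cardinal $\kappa = \kappa(\mathfrak{Small})$; its elements are called small sets. Let $\alpha \leq \kappa(\mathfrak{Small})$ be an (infinite) regular cardinal. It is a strong limit cardinal if $2^\beta<\alpha$ for every cardinal $\beta<\alpha$. A set is $\alpha$-small if it is small and has cardinality less than $\alpha$. Fix a set $\mathfrak{J}_\alpha$ of sets with $\mathfrak{Card}_\alpha \subseteq \mathfrak{J}_\alpha \subseteq \mathfrak{Small}_\alpha$, where $\mathfrak{Card}_\alpha$ is the set of all $\alpha$-small cardinals and $\mathfrak{Small}_\alpha$ is the set of all $\alpha$-small sets. Given a set $A$, a $\mathfrak{J}_\alpha$-ary operation on $A$ is a map $A^J \to A$ with $J \in \mathfrak{J}_\alpha$ (its arity); nullary operations are allowed. A $\mathfrak{J}_\alpha$-ary clone on $A$ is a set $F$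 of $\mathfrak{J}_\alpha$-ary operations on $A$ that contains all projections $\pi_j:A^J\to A$ ($J\in\mathfrak{J}_\alpha$, $j\in J$) and is such that for all $J,K\in\mathfrak{J}_\alpha$, every $f:A^K\to A$ in $F$ and every family $g_k:A^J\to A$ $(k\in K)$ in $F$, the composite $f\circ(g_k)_{k\in K}:A^J\to A$ lies in $F$. Operations $f:A^X\to A$ and $g:A^Y\to A$ commute, written $f\perp g$, if for every matrix $a=(a_{xy})\in A^{X\times Y}$ one has $g\bigl((f((a_{xy})_{x\in X}))_{y\in Y}\bigr)=f\bigl((g((a_{xy})_{y\in Y}))_{x\in X}\bigr)$. The $\mathfrak{J}_\alpha$-ary centralizer $G^\perp$ of a set $G$ of $\mathfrak{J}_\alpha$-ary operations on $A$ is the set of all $\mathfrak{J}_\alpha$-ary operations $f$ on $A$ with $f\perp g$ for all $g\in G$. Convention: if $\alpha$ is a strong limit cardinal, $A$ is $\alpha$-small and $J\in\mathfrak{J}_\alpha$, then $A^J$ is $\alpha$-small and is identified with an equinumerous set in $\mathfrak{J}_\alpha$. Thus "an operation $h:A^{(A^J)}\to A$ of arity $A^J$ in $G$" means a map $h:A^{(A^J)}\to A$ such that, for a chosen bijection $\phi:K\to A^J$ with $K\in\mathfrak{J}_\alpha$, the corresponding operation $A^K\cong A^{(A^J)}\xrightarrow{h}A$ (reindexing along $\phi$) lies in $G$; since $G$ is a clone, this does not depend on the choice of $K$ and $\phi$. In $h(f)$, the map $f:A^J\to A$ is regarded as an element of $A^{(A^J)}$; and $h\circ u_J:J\to A$ is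 regarded as an element of $A^J$. -}

module Defs where

open import Data.Bool.Base using (Bool)
open import Data.Nat.Base using (ℕ)
open import Data.Product.Base using (Σ-syntax; ∃-syntax; _×_; _,_)
open import Data.Sum.Base using (_⊎_)
open import Function.Base using (_∘_)
open import Function.Bundles using (_↔_; _↣_; Inverse)
open import Function.Definitions using (Injective)
open import Induction.WellFounded using (WellFounded)
open import Level using (Level; _⊔_; suc)
open import Relation.Binary.Core using (Rel)
open import Relation.Binary.PropositionalEquality.Core using (_≡_)
open import Relation.Binary.Structures using (IsStrictTotalOrder)
open import Relation.Nullary.Negation.Core using (¬_)
open import Relation.Unary using (Pred; _∈_)

-- Small sets are the types in a fixed but arbitrary universe Set ℓ, and κ is
-- the supremum of the small ordinals.  An ordinal α is ≤ κ exactly when each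
-- of its elements β is itself a small set.  Here an ordinal α ≤ κ is presented
-- as a well-ordered type Carrier (the elements β < α) together with, for every
-- β, the small set Seg β that β "is" in the von Neumann sense: element
-- enumerates, without repetition, the γ with γ < β.  The enumeration is used
-- in place of ∃[ γ ] γ < β because the latter is not small, and because _<_
-- need not be proof-irrelevant.

record Ordinal (ℓ : Level) : Set (suc (suc ℓ)) where
  infix 4 _<_
  field
    Carrier            : Set (suc ℓ)
    _<_                : Rel Carrier (suc ℓ)
    isStrictTotalOrder : IsStrictTotalOrder _≡_ _<_
    wellFounded        : WellFounded _<_
    Seg                : Carrier → Set ℓ
    element            : ∀ {β} → Seg β → Carrier
    element-injective  : ∀ {β} → Injective _≡_ _≡_ (element {β})
    element-<          : ∀ {β} (x : Seg β) → element x < β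
    element-surjective : ∀ {β γ} → γ < β → ∃[ x ] element {β} x ≡ γ

module _ {ℓ : Level} (α : Ordinal ℓ) where
  open Ordinal α

  -- A cardinal is an ordinal not equinumerous to any of its elements; stated
  -- first for an element β of α, then for α itself.
  IsCardinalBelow : Pred Carrier (suc ℓ)
  IsCardinalBelow β = ∀ γ → γ < β → ¬ (Seg γ ↔ Seg β)

  IsCardinal : Set (suc ℓ)
  IsCardinal = ∀ β → ¬ (Seg β ↔ Carrier)

  -- The cardinality of X is the cardinal equinumerous to X, and it is less
  -- than α when it is an element of α.
  Small : Pred (Set ℓ) (suc ℓ)
  Small X = ∃[ β ] IsCardinalBelow β × (X ↔ Seg β)

  Card : Pred (Set ℓ) (suc ℓ)
  Card X = ∃[ β ] IsCardinalBelow β × X ≡ Seg β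

  Infinite : Set (suc ℓ)
  Infinite = ℕ ↣ Carrier

  Cofinal : {X : Set ℓ} → (X → Carrier) → Set (suc ℓ)
  Cofinal f = ∀ γ → ∃[ x ] (γ < f x ⊎ γ ≡ f x)

  -- Regularity: no β < α admits a cofinal map to α, i.e. cf(α) = α.
  record IsRegularCardinal : Set (suc ℓ) where
    field
      isCardinal : IsCardinal
      infinite   : Infinite
      regular    : ∀ β (f : Seg β → Carrier) → ¬ Cofinal f

  IsStrongLimit : Set (suc ℓ)
  IsStrongLimit = ∀ β → IsCardinalBelow β → Small (Seg β → Bool)

-- An operation carries its arity.  That the arity lies in 𝔍 is a separate
-- condition, so that operations do not depend on a proof of membership in 𝔍.
record Operation {ℓ} (A : Set ℓ) : Set (suc ℓ) where
  constructor op
  field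
    arity : Set ℓ
    map   : (arity → A) → A

open Operation public

module _ {ℓ} {A : Set ℓ} where

  π : {J : Set ℓ} → J → (J → A) → A
  π j a = a j

  infix 4 _⊥_
  _⊥_ : Rel (Operation A) ℓ
  op X f ⊥ op Y g = (a : X × Y → A) →
    g (λ y → f (λ x → a (x , y))) ≡ f (λ x → g (λ y → a (x , y)))

  module _ {j} (𝔍 : Pred (Set ℓ) j) where

    record IsClone {g} (G : Pred (Operation A) g) : Set (suc ℓ ⊔ j ⊔ g) where
      field
        arities     : ∀ {f} → f ∈ G → arity f ∈ 𝔍
        projections : ∀ {J} → J ∈ 𝔍 → (i : J) → op J (π i) ∈ G
        composites  : ∀ {J K} → J ∈ 𝔍 → K ∈ 𝔍 →
                      (f : (K → A) → A) → op K f ∈ G →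
                      (g : K → (J → A) → A) → (∀ k → op J (g k) ∈ G) →
                      op J (λ a → f (λ k → g k a)) ∈ G

    Centralizer : ∀ {g} → Pred (Operation A) g →
                  Pred (Operation A) (suc ℓ ⊔ j ⊔ g)
    Centralizer G f = arity f ∈ 𝔍 × (∀ g → g ∈ G → f ⊥ g)

    -- h : A^X → A, with X not necessarily in 𝔍, is an operation in G after
    -- reindexing along some bijection K ↔ X with K ∈ 𝔍.  If G is a clone, the
    -- choice of K and of the bijection is immaterial.
    OperationIn : ∀ {g} → Pred (Operation A) g → (X : Set ℓ) →
                  Pred ((X → A) → A) (suc ℓ ⊔ j ⊔ g)
    OperationIn G X h = Σ[ K ∈ Set ℓ ] K ∈ 𝔍 × Σ[ φ ∈ K ↔ X ]
      op K (λ a → h (a ∘ Inverse.from φ)) ∈ G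

  u : (J : Set ℓ) → J → (J → A) → A
  u J j = π j

{-# OPTIONS --safe #-}

-- If f commutes with h : A^(A^J) → A, applying both to the evaluation matrix
-- J × A^J → A gives h(f) = f(h ∘ u_J).  Conversely, given g : A^Y → A in G and
-- a matrix a : J × Y → A, the operation h(p) = g(y ↦ p(a(–, y))) is a composite
-- of g with projections, hence lies in G, and h(f) = f(h ∘ u_J) says that f and
-- g commute on a.  For h to have an arity in 𝔍, the set A^J must be α-small:
-- it embeds in an iterated power set of an α-small set, and α-small sets are
-- closed under power sets (strong limit) and subsets (Mostowski collapse).

module Submission where

open import Defs
open import Axiom.ExcludedMiddle using (ExcludedMiddle)
open import Axiom.Extensionality.Propositional using (Extensionality)
open import Data.Bool.Base using (Bool; true; not; T)
open import Data.Bool.Properties using (not-injective)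
open import Data.Product.Base using (Σ-syntax; ∃-syntax; _×_; _,_; proj₁; proj₂)
open import Data.Sum.Base using (_⊎_; inj₁; inj₂; [_,_]′)
open import Function.Base using (_∘_; _on_)
open import Function.Bundles using (_↔_; _↣_; Inverse; Injection; mk↔ₛ′; mk↣)
open import Function.Construct.Composition using (_↔-∘_; _↣-∘_)
open import Function.Construct.Identity using (↔-id; ↣-id)
open import Function.Construct.Symmetry using (↔-sym)
open import Function.Properties.Inverse using (↔⇒↣)
open import Function.Related.TypeIsomorphisms using (→-cong-↔)
open import Induction.WellFounded using (WfRec; module All; module FixPoint)
open import Relation.Binary.Construct.On as On using ()
open import Relation.Binary.Core using (Rel)
open import Relation.Binary.Definitions using (tri<; tri≈; tri>)
open import Relation.Binary.PropositionalEquality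
  using (_≡_; _≢_; refl; sym; trans; cong; cong-app; subst)
open import Relation.Binary.Structures using (IsStrictTotalOrder)
open import Relation.Nullary.Decidable.Core
  using (yes; no; ⌊_⌋; toWitness; fromWitness; decidable-stable)
open import Relation.Nullary.Negation.Core using (¬_; contradiction)
open import Relation.Unary using (Pred; _∈_; _⊆_; _≐_)

module Classical
  (em : ∀ {a} → ExcludedMiddle a) (ext : ∀ {a b} → Extensionality a b) where

  -- Embeddings into double power sets

  indicator : ∀ {p} → Set p → Bool
  indicator P = ⌊ em {P = P} ⌋

  -- Each point goes to the principal ultrafilter at its image, and testing that ultrafilter on the
  -- singleton of the image recovers the point.
  ↣-double-power : ∀ {x y} {X : Set x} {Y : Set y} → X ↣ Y → X ↣ ((Y → Bool) → Bool)
  ↣-double-power i = mk↣ {to = λ x S → S (to x)} λ {x} eq →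
      injective (toWitness (subst T
        (cong-app eq (λ y → indicator (to x ≡ y))) (fromWitness refl)))
    where open Injection i

  -- Principal ultrafilters for the left summand, their complements for the
  -- right one: the full subset tells the two apart.
  ⊎-↣-double-power : ∀ {x y m} {X : Set x} {Y : Set y} {M : Set m} →
                     X ↣ M → Y ↣ M → (X ⊎ Y) ↣ ((M → Bool) → Bool)
  ⊎-↣-double-power {X = X} {Y} {M} i k = mk↣ {to = φ} φ-injective
    where
    i′ = ↣-double-power i
    k′ = ↣-double-power k

    φ : X ⊎ Y → (M → Bool) → Bool
    φ = [ Injection.to i′ , (λ y → not ∘ Injection.to k′ y) ]′

    φ-injective : ∀ {v w} → φ v ≡ φ w → v ≡ w
    φ-injective {inj₁ _} {inj₁ _} eq = cong inj₁ (Injection.injective i′ eq)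
    φ-injective {inj₁ _} {inj₂ _} eq with () ← cong-app eq (λ _ → true)
    φ-injective {inj₂ _} {inj₁ _} eq with () ← cong-app eq (λ _ → true)
    φ-injective {inj₂ _} {inj₂ _} eq =
      cong inj₂ (Injection.injective k′ (ext (not-injective ∘ cong-app eq)))

  -- f is determined by the collection of all W ⊆ X ⊎ Y closed under f: the set
  -- {x, f x} is closed under f, and if it is closed under f′ then f′ x = f x.
  →-↣-double-power : ∀ {x y} {X : Set x} {Y : Set y} →
                     (X → Y) ↣ ((X ⊎ Y → Bool) → Bool)
  →-↣-double-power {X = X} {Y} = mk↣ {to = λ f W → indicator (Closed f W)} injective
    where
    Closed : (X → Y) → (X ⊎ Y → Bool) → Set _
    Closed f W = ∀ x → T (W (inj₁ x)) → T (W (inj₂ (f x)))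

    edge : (X → Y) → X → X ⊎ Y → Bool
    edge f x = [ (λ x′ → indicator (x′ ≡ x)) , (λ y → indicator (y ≡ f x)) ]′

    edge-closed : ∀ f x → Closed f (edge f x)
    edge-closed f x x′ x′≡x = fromWitness (cong f (toWitness x′≡x))

    injective : ∀ {f f′} → (λ W → indicator (Closed f W)) ≡ (λ W → indicator (Closed f′ W)) →
                f ≡ f′
    injective {f} {f′} eq = ext λ x → sym (toWitness
      (toWitness (subst T (cong-app eq (edge f x)) (fromWitness (edge-closed f x)))
        x (fromWitness refl)))

  -- Ordinal segments and the Mostowski collapse

  module _ {ℓ} (α : Ordinal ℓ) where
    open Ordinal α
    open IsStrictTotalOrder isStrictTotalOrder using (compare; irrefl)
      renaming (trans to <-trans)

    Least : ∀ {p} → Pred Carrier p → Set _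
    Least P = ∃[ μ ] P μ × (∀ {γ} → γ < μ → ¬ P γ)

    opaque
      least : ∀ {p} (P : Pred Carrier p) → ∃[ γ ] P γ → Least P
      least P (γ , Pγ) = All.wfRec wellFounded _ (λ γ → P γ → Least P) step γ Pγ
        where
        step : ∀ γ → WfRec _<_ (λ γ → P γ → Least P) γ → P γ → Least P
        step γ rec Pγ with em {P = ∃[ δ ] δ < γ × P δ}
        ... | yes (_ , δ<γ , Pδ) = rec δ<γ Pδ
        ... | no none            = γ , Pγ , λ δ<γ Pδ → none (_ , δ<γ , Pδ)

    Seg-mono : ∀ {β γ} → β < γ → Seg β ↣ Seg γ
    Seg-mono β<γ = mk↣ {to = λ x → proj₁ (in-γ x)} λ {x} {y} eq →
        element-injective
          (trans (sym (proj₂ (in-γ x))) (trans (cong element eq) (proj₂ (in-γ y))))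
      where
      in-γ = λ x → element-surjective (<-trans (element-< x) β<γ)

    -- The least ordinal equinumerous to `X` is a cardinal.
    ↔Seg⇒Small : ∀ {X β} → X ↔ Seg β → Small α X
    ↔Seg⇒Small {X} φ with least (λ β → X ↔ Seg β) (_ , φ)
    ... | μ , ψ , minimal = μ , (λ γ γ<μ χ → minimal γ<μ (↔-sym χ ↔-∘ ψ)) , ψ

    -- A downward closed range is exactly the segment below the least ordinal `μ` that it misses;
    -- `β` is missed, so `μ` exists.
    initial⇒↔Seg : ∀ {X : Set ℓ} {β} (c : X → Carrier) →
      (∀ {x y} → c x ≡ c y → x ≡ y) →
      (∀ {x γ} → γ < c x → ∃[ y ] c y ≡ γ) →
      (∀ x → c x < β) →
      ∃[ μ ] X ↔ Seg μ
    initial⇒↔Seg c c-injective c-initial c<β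
      with μ , μ∉c , minimal ← least (λ γ → ¬ (∃[ x ] c x ≡ γ))
             (_ , λ (x , cx≡β) → irrefl cx≡β (c<β x))
      = μ , mk↔ₛ′ (λ x → proj₁ (to x)) (λ s → proj₁ (from s))
          (λ s → element-injective (trans (proj₂ (to _)) (proj₂ (from s))))
          (λ x → c-injective (trans (proj₂ (from _)) (proj₂ (to x))))
      where
      c<μ : ∀ x → c x < μ
      c<μ x with compare (c x) μ
      ... | tri< lt _ _ = lt
      ... | tri≈ _ eq _ = contradiction (x , eq) μ∉c
      ... | tri> _ _ gt = contradiction (c-initial gt) μ∉c

      to = λ x → element-surjective (c<μ x)
      from = λ s → decidable-stable em (minimal (element-< s))

    module Collapse {X : Set ℓ} {β} (i : X ↣ Seg β) where
      e : X → Carrier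
      e = element ∘ Injection.to i

      _≺_ : Rel X _
      _≺_ = _<_ on e

      -- The bound guarantees that some ordinal, namely e x, is not yet taken.
      Value : Pred X _
      Value x = ∃[ γ ] ¬ e x < γ

      Fresh : ∀ x → WfRec _≺_ Value x → Pred Carrier _
      Fresh x rec γ = ∀ {y} (y≺x : y ≺ x) → proj₁ (rec y≺x) ≢ γ

      -- A predecessor `y` with value `e x` would violate its own bound, as `e y < e x`.
      e-fresh : ∀ x (rec : WfRec _≺_ Value x) → Fresh x rec (e x)
      e-fresh x rec y≺x eq = proj₂ (rec y≺x) (subst (_ <_) (sym eq) y≺x)

      leastFresh : ∀ x (rec : WfRec _≺_ Value x) → Least (Fresh x rec)
      leastFresh x rec = least (Fresh x rec) (e x , e-fresh x rec)

      step : ∀ x → WfRec _≺_ Value x → Value x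
      step x rec with μ , _ , minimal ← leastFresh x rec =
        -- The bound persists: if `e x` were below `μ`, it would be a fresh ordinal smaller than the
        -- least one.
        μ , λ ex<μ → minimal ex<μ (e-fresh x rec)

      opaque
        collapse : ∀ x → Value x
        collapse = All.wfRec (On.wellFounded e wellFounded) _ Value step

      c : X → Carrier
      c = proj₁ ∘ collapse

      rec′ : ∀ x → WfRec _≺_ Value x
      rec′ x {y} _ = collapse y

      opaque
        unfolding collapse

        c-unfold : ∀ x → c x ≡ proj₁ (leastFresh x (rec′ x))
        c-unfold x = cong proj₁ (FixPoint.unfold-wfRec (On.wellFounded e wellFounded)
          Value step step-ext {x})
          where
          step-ext : ∀ x {rec rec′ : WfRec _≺_ Value x} →
                     (∀ {y} (y≺x : y ≺ x) → rec y≺x ≡ rec′ y≺x) → step x rec ≡ step x rec′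
          -- `ext` compares functions of an explicit argument, so the implicit `y` is made explicit
          -- first.
          step-ext x eq = cong (λ (r : ∀ y → y ≺ x → Value y) → step x (r _))
            (ext λ y → ext (eq {y}))

      c-fresh : ∀ {x y} → y ≺ x → c y ≢ c x
      c-fresh {x} y≺x rewrite c-unfold x = proj₁ (proj₂ (leastFresh x (rec′ x))) y≺x

      -- An untaken `γ` would be fresh for `x`, against the minimality of `c x`.
      c-initial : ∀ {x γ} → γ < c x → ∃[ y ] c y ≡ γ
      c-initial {x} γ<cx = decidable-stable em λ none →
        proj₂ (proj₂ (leastFresh x (rec′ x))) (subst (_ <_) (c-unfold x) γ<cx)
          λ {y} _ cy≡γ → none (y , cy≡γ)

      c-injective : ∀ {x y} → c x ≡ c y → x ≡ y
      c-injective {x} {y} eq with compare (e x) (e y)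
      ... | tri< lt _ _ = contradiction eq (c-fresh lt)
      ... | tri≈ _ e≡ _ = Injection.injective i (element-injective e≡)
      ... | tri> _ _ gt = contradiction (sym eq) (c-fresh gt)

      -- The bound keeps `c x` at or below `e x`, which lies in the segment of `β`.
      c<β : ∀ x → c x < β
      c<β x with compare (c x) β
      ... | tri< lt _ _ = lt
      ... | tri≈ _ eq _ = contradiction (subst (_ <_) (sym eq) (element-< _)) (proj₂ (collapse x))
      ... | tri> _ _ gt = contradiction (<-trans (element-< _) gt) (proj₂ (collapse x))

      collapse-↔Seg : ∃[ μ ] X ↔ Seg μ
      collapse-↔Seg = initial⇒↔Seg c c-injective c-initial c<β

    -- Closure properties of α-small sets

    ↣-Small : ∀ {X Y} → X ↣ Y → Small α Y → Small α X
    ↣-Small i (_ , _ , φ) = ↔Seg⇒Small (proj₂ (Collapse.collapse-↔Seg (↔⇒↣ φ ↣-∘ i)))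

    -- This supplies the common target that `⊎-↣-double-power` asks for: cardinals are comparable,
    -- so the larger of the two sets will do.
    Small-upperBound : ∀ {X Y} → Small α X → Small α Y →
                       Σ[ M ∈ Set ℓ ] Small α M × (X ↣ M) × (Y ↣ M)
    Small-upperBound {X} {Y} X-small@(β , _ , φ) Y-small@(γ , _ , ψ) with compare β γ
    ... | tri< β<γ _ _  = Y , Y-small , ↔⇒↣ (↔-sym ψ) ↣-∘ (Seg-mono β<γ ↣-∘ ↔⇒↣ φ) , ↣-id Y
    ... | tri≈ _ refl _ = X , X-small , ↣-id X , ↔⇒↣ (↔-sym φ ↔-∘ ψ)
    ... | tri> _ _ γ<β  = X , X-small , ↣-id X , ↔⇒↣ (↔-sym φ) ↣-∘ (Seg-mono γ<β ↣-∘ ↔⇒↣ ψ)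

    module _ (strongLimit : IsStrongLimit α) where

      power-Small : ∀ {X} → Small α X → Small α (X → Bool)
      power-Small (β , β-cardinal , φ) with strongLimit β β-cardinal
      ... | γ , γ-cardinal , ψ = γ , γ-cardinal , ψ ↔-∘ →-cong-↔ ext ext φ (↔-id Bool)

      ⊎-Small : ∀ {X Y} → Small α X → Small α Y → Small α (X ⊎ Y)
      ⊎-Small X-small Y-small with Small-upperBound X-small Y-small
      ... | _ , M-small , i , k =
        ↣-Small (⊎-↣-double-power i k) (power-Small (power-Small M-small))

      →-Small : ∀ {X Y} → Small α X → Small α Y → Small α (X → Y)
      →-Small X-small Y-small =
        ↣-Small →-↣-double-power (power-Small (power-Small (⊎-Small X-small Y-small)))

-- Centralizers and evaluation

module _ {ℓ j g} {A : Set ℓ} (𝔍 : Pred (Set ℓ) j) (G : Pred (Operation A) g) where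

  centralizer-evaluation :
    Extensionality ℓ ℓ → ∀ {f} → f ∈ Centralizer 𝔍 G →
    ∀ h → OperationIn 𝔍 G (arity f → A) h → h (map f) ≡ map f (h ∘ u (arity f))
  centralizer-evaluation ext {f} (_ , f⊥) h (_ , _ , φ , h∈G) =
    trans (cong h (ext λ p → sym (cong (map f) (to∘from p))))
      -- Entry `(i , k)` is coordinate `i` of the tuple coded by `k`: column `k` lists that tuple,
      -- and row `i` is the projection `π i` reindexed along `φ`.
      (trans (f⊥ _ h∈G λ (i , k) → to k i)
        (cong (map f) (ext λ i → cong h (ext λ p → cong-app (to∘from p) i))))
    where
    open Inverse φ renaming (strictlyInverseˡ to to∘from)

  evaluation-centralizer :
    IsClone 𝔍 G → ∀ {f} → arity f ∈ 𝔍 →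
    (Σ[ K ∈ Set ℓ ] K ∈ 𝔍 × (K ↔ (arity f → A))) →
    (∀ h → OperationIn 𝔍 G (arity f → A) h → h (map f) ≡ map f (h ∘ u (arity f))) →
    f ∈ Centralizer 𝔍 G
  evaluation-centralizer clone J∈𝔍 (K , K∈𝔍 , φ) evaluation =
    J∈𝔍 , λ (op Y g) g∈G a →
      evaluation (λ p → g λ y → p λ i → a (i , y))
        (K , K∈𝔍 , φ ,
          composites K∈𝔍 (arities g∈G) g g∈G _
            -- Evaluating `p` at column `y` of `a` is a projection, whose index is the code of that
            -- column under `φ`.
            λ y → projections K∈𝔍 (Inverse.from φ λ i → a (i , y)))
    where open IsClone clone

theorem5p7 : (∀ {a} → ExcludedMiddle a) → (∀ {a b} → Extensionality a b) →
    ∀ {ℓ j g} (α : Ordinal ℓ) → IsRegularCardinal α → IsStrongLimit α →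
    (𝔍 : Pred (Set ℓ) j) → Card α ⊆ 𝔍 → 𝔍 ⊆ Small α →
    (A : Set ℓ) → A ∈ Small α →
    (G : Pred (Operation A) g) → IsClone 𝔍 G →
    Centralizer 𝔍 G ≐
    (λ (f : Operation A) → arity f ∈ 𝔍 ×
    ((h : ((arity f → A) → A) → A) → OperationIn 𝔍 G (arity f → A) h →
    h (map f) ≡ map f (h ∘ u (arity f))))
theorem5p7 em ext {ℓ} α _ strongLimit 𝔍 Card⊆𝔍 𝔍⊆Small A A-small G clone =
    (λ f∈ → proj₁ f∈ , centralizer-evaluation 𝔍 G ext f∈) ,
    (λ (J∈𝔍 , evaluation) →
      evaluation-centralizer 𝔍 G clone J∈𝔍 (power-arity J∈𝔍) evaluation)
  where
  open Classical em ext

  -- The cardinal of `J → A` serves as the arity, since `𝔍` contains all α-small cardinals.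
  power-arity : ∀ {J} → J ∈ 𝔍 → Σ[ K ∈ Set ℓ ] K ∈ 𝔍 × (K ↔ (J → A))
  power-arity J∈𝔍 =
    let β , β-cardinal , φ = →-Small α strongLimit (𝔍⊆Small J∈𝔍) A-small
    in Ordinal.Seg α β , Card⊆𝔍 (β , β-cardinal , refl) , ↔-sym φ
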